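{- Every deterministic algorithm that correctly solves Stone Game III (on every input sequence of $n$ integers) must, in the worst case, inspect all $n$ input positions. That is, for every input length $n$ and every deterministic algorithm in the random-access input model that outputs the correct answer in $\{\texttt{Alice},\texttt{Bob},\texttt{Tie}\}$ on every integer input $(v_0,\ldots,v_{n-1})$, there is an input of length $n$ on which the algorithm inspects every one of the $n$ positions.
   Context: Stone Game III: a row of $n$ stones has integer values $v_0,v_1,\ldots,v_{n-1}$. Alice and Bob alternate turns, Alice moving first. On each turn a player removes the first one, two, or three remaining stones (no more than remain) and adds their values to his or her own score. Play ends when no stones remain. Both players know all values and play optimally (each maximizes own final score, equivalently own score minus the opponent's score). The required output is $\texttt{Alice}$, $\texttt{Bob}$ or $\texttt{Tie}$ according to the final scores under optimal play (the player with the higher score wins; equal scores are a tie). Random-access input model (deterministic query / decision-tree model): the length $n$ is known, and a deterministic algorithm may inspect any chosen position $i$, learning $v_i$, at unit cost. The choice of the next position may depend on all values inspected so far. Other unit-cost arithmetic and control operations are allowed. The algorithm's execution and output on an input depend on that input only through $n$ and the values inspected. -}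

module Defs where

open import Data.Bool using (if_then_else_)
open import Data.Fin using (Fin)
open import Data.Integer using (ℤ; 0ℤ; _+_; _≤ᵇ_)
open import Data.Integer.Properties using (<-cmp)
open import Data.List using (List; []; _∷_)
open import Data.List.Membership.Propositional using (_∈_)
open import Data.Nat using (ℕ)
open import Data.Product using (_×_; _,_; proj₁; ∃-syntax)
open import Data.Vec using (Vec; lookup; toList)
open import Relation.Binary.Definitions using (tri<; tri≈; tri>)
open import Relation.Binary.PropositionalEquality using (_≡_)

-- Final scores, counted from the current position onwards:
-- the player to move first, the opponent second.
Scores : Set
Scores = ℤ × ℤ

-- The player to move collects g, and the opponent becomes the player to move.
collect : ℤ → Scores → Scores
collect g (mover , other) = g + other , mover

-- The player to move keeps the option with the larger own final score.  How
-- equal options are resolved is immaterial: both players' scores always add up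
-- to the sum of the remaining stones, so such options have equal scores for
-- the opponent too.
prefer : Scores → Scores → Scores
prefer p q = if proj₁ q ≤ᵇ proj₁ p then p else q

optimalScores : List ℤ → Scores
optimalScores []              = 0ℤ , 0ℤ
optimalScores (a ∷ [])        = collect a (optimalScores [])
optimalScores (a ∷ b ∷ [])    =
  prefer (collect a       (optimalScores (b ∷ [])))
         (collect (a + b) (optimalScores []))
optimalScores (a ∷ b ∷ c ∷ r) =
  prefer (collect a           (optimalScores (b ∷ c ∷ r)))
 (prefer (collect (a + b)     (optimalScores (c ∷ r)))
         (collect (a + b + c) (optimalScores r)))

data Answer : Set where
  Alice Bob Tie : Answer

compareScores : Scores → Answer
compareScores (alice , bob) with <-cmp alice bob
... | tri< _ _ _ = Bob
... | tri≈ _ _ _ = Tie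
... | tri> _ _ _ = Alice

stoneGameIII : ∀ {n} → Vec ℤ n → Answer
stoneGameIII v = compareScores (optimalScores (toList v))

-- One step of an algorithm for inputs of length n, with internal states S.
data Action (n : ℕ) (S : Set) : Set where
  output  : Answer → Action n S
  compute : S → Action n S
  inspect : Fin n → (ℤ → S) → Action n S

-- A deterministic random-access algorithm for inputs of length n.  The input
-- is reachable only through `inspect`; the state may record everything learned
-- so far.  Internal computation is unrestricted, positions may be inspected
-- repeatedly, and halting is not built in.
record Algorithm (n : ℕ) : Set₁ where
  field
    State : Set
    start : State
    step  : State → Action n State

module _ {n : ℕ} (A : Algorithm n) where
  open Algorithm A

  -- RunFrom v s is r: on input v, started in state s, the algorithm halts with
  -- answer r after inspecting exactly the positions is, in this order.
  data RunFrom (v : Vec ℤ n) : State → List (Fin n) → Answer → Set where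
    halts    : ∀ {s r} → step s ≡ output r → RunFrom v s [] r
    computes : ∀ {s s′ is r} → step s ≡ compute s′ →
               RunFrom v s′ is r → RunFrom v s is r
    inspects : ∀ {s i k is r} → step s ≡ inspect i k →
               RunFrom v (k (lookup v i)) is r → RunFrom v s (i ∷ is) r

  Run : Vec ℤ n → List (Fin n) → Answer → Set
  Run v = RunFrom v start

  SolvesStoneGameIII : Set
  SolvesStoneGameIII = ∀ v → ∃[ is ] Run v is (stoneGameIII v)

  InspectsEveryPosition : Vec ℤ n → Set
  InspectsEveryPosition v = ∃[ is ] ∃[ r ] Run v is r × (∀ i → i ∈ is)

{-# OPTIONS --safe #-}

-- The all-zero input is a tie.  The final scores add up to the sum of the
-- stones, so setting a single zero to 1 makes that sum odd and rules out a tie.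
-- A correct algorithm therefore cannot skip any position of the zero input:
-- its run would be the same on the two inputs, whose answers differ.
module Submission where

open import Data.Bool using (true; false)
open import Data.Empty using (⊥-elim)
open import Data.Fin using (Fin; zero; suc; _≟_)
open import Data.Integer using (ℤ; +_; -[1+_]; 0ℤ; 1ℤ; _+_; _≤ᵇ_)
open import Data.Integer.Properties using (+-assoc; +-comm; +-identityˡ; <-cmp)
open import Data.List using (List; []; _∷_; foldr)
open import Data.List.Membership.DecPropositional using (_∈?_)
open import Data.List.Membership.Propositional using (_∈_)
open import Data.List.Relation.Unary.Any using (here; there)
open import Data.Nat using (ℕ; zero; suc)
open import Data.Nat.Properties using (+-suc)
open import Data.Product using (Σ-syntax; _,_; proj₁; proj₂)
open import Data.Vec using (Vec; lookup; replicate; toList; _[_]≔_)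
open import Data.Vec.Properties using (lookup∘update′)
open import Relation.Binary.Definitions using (tri<; tri≈; tri>)
open import Relation.Binary.PropositionalEquality
open import Relation.Nullary using (¬_)
open import Relation.Nullary.Decidable using (decidable-stable)
open import Defs

sumℤ : List ℤ → ℤ
sumℤ = foldr _+_ 0ℤ

total : Scores → ℤ
total (mover , other) = mover + other

total-collect : ∀ g p {t} → total p ≡ t → total (collect g p) ≡ g + t
total-collect g (mover , other) refl =
  trans (+-assoc g other mover) (cong (_+_ g) (+-comm other mover))

total-prefer : ∀ p q {t} → total p ≡ t → total q ≡ t → total (prefer p q) ≡ t
total-prefer p q p≡t q≡t with proj₁ q ≤ᵇ proj₁ p
... | true  = p≡t
... | false = q≡t

-- Whichever move is made, the stones taken and the stones left add up to the same sum, so the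
-- outcome of the comparison in `prefer` cannot change the total. The recursion follows the clauses
-- of `optimalScores`; associativity only matches the right-nested `sumℤ`.
total-optimalScores : ∀ xs → total (optimalScores xs) ≡ sumℤ xs
total-optimalScores []           = refl
total-optimalScores (a ∷ [])     = total-collect a (0ℤ , 0ℤ) refl
total-optimalScores (a ∷ b ∷ []) =
  total-prefer (collect a (optimalScores (b ∷ []))) (collect (a + b) (0ℤ , 0ℤ))
    (total-collect a (optimalScores (b ∷ [])) (total-optimalScores (b ∷ [])))
    (trans (total-collect (a + b) (0ℤ , 0ℤ) refl) (+-assoc a b 0ℤ))
total-optimalScores (a ∷ b ∷ c ∷ r) =
  total-prefer (collect a (optimalScores (b ∷ c ∷ r))) (prefer take₂ take₃)
    (total-collect a (optimalScores (b ∷ c ∷ r)) (total-optimalScores (b ∷ c ∷ r)))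
    (total-prefer take₂ take₃
      (trans (total-collect (a + b) (optimalScores (c ∷ r)) (total-optimalScores (c ∷ r)))
             (+-assoc a b _))
      (trans (total-collect (a + b + c) (optimalScores r) (total-optimalScores r))
             (trans (+-assoc (a + b) c _) (+-assoc a b _))))
  where
  take₂ = collect (a + b) (optimalScores (c ∷ r))
  take₃ = collect (a + b + c) (optimalScores r)

i+i≢1 : ∀ i → i + i ≢ 1ℤ
i+i≢1 (+ zero)  ()
-- The left side computes to `+ suc (n + suc n)`; `+-suc` exposes a second successor, which `1ℤ`
-- lacks.
i+i≢1 (+ suc n) eq rewrite +-suc n n with () ← eq
i+i≢1 -[1+ n ]  ()

compareScores-Tie : ∀ p → compareScores p ≡ Tie → proj₁ p ≡ proj₂ p
compareScores-Tie (alice , bob) eq with <-cmp alice bob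
compareScores-Tie _ () | tri< _ _ _
compareScores-Tie _ _  | tri≈ _ alice≡bob _ = alice≡bob
compareScores-Tie _ () | tri> _ _ _

sum≡1⇒¬Tie : ∀ {n} (v : Vec ℤ n) → sumℤ (toList v) ≡ 1ℤ → stoneGameIII v ≢ Tie
sum≡1⇒¬Tie v sum≡1 tie = i+i≢1 (proj₁ p) (begin
  proj₁ p + proj₁ p  ≡⟨ cong (_+_ (proj₁ p)) (compareScores-Tie p tie) ⟩
  total p            ≡⟨ total-optimalScores (toList v) ⟩
  sumℤ (toList v)    ≡⟨ sum≡1 ⟩
  1ℤ                 ∎)
  where
  open ≡-Reasoning
  p = optimalScores (toList v)

zeros : ∀ n → Vec ℤ n
zeros n = replicate n 0ℤ

optimalScores-zeros : ∀ n → optimalScores (toList (zeros n)) ≡ (0ℤ , 0ℤ)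
optimalScores-zeros 0 = refl
optimalScores-zeros 1 = refl
optimalScores-zeros 2 = refl
optimalScores-zeros (suc (suc (suc n))) =
  step (optimalScores-zeros (suc (suc n))) (optimalScores-zeros (suc n)) (optimalScores-zeros n)
  where
  -- With the three recursive results replaced by variables, matching on `refl` makes them all zero
  -- and the rest computes.
  step : ∀ {p q r} → p ≡ (0ℤ , 0ℤ) → q ≡ (0ℤ , 0ℤ) → r ≡ (0ℤ , 0ℤ) →
    prefer (collect 0ℤ p) (prefer (collect 0ℤ q) (collect 0ℤ r)) ≡ (0ℤ , 0ℤ)
  step refl refl refl = refl

zeros-Tie : ∀ n → stoneGameIII (zeros n) ≡ Tie
zeros-Tie n = cong compareScores (optimalScores-zeros n)

sum-zeros : ∀ n → sumℤ (toList (zeros n)) ≡ 0ℤ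
sum-zeros zero    = refl
sum-zeros (suc n) = trans (+-identityˡ _) (sum-zeros n)

sum-zeros[i]≔1 : ∀ {n} (i : Fin n) → sumℤ (toList (zeros n [ i ]≔ 1ℤ)) ≡ 1ℤ
sum-zeros[i]≔1 {suc n} zero    = cong (_+_ 1ℤ) (sum-zeros n)
sum-zeros[i]≔1 {suc n} (suc i) = trans (+-identityˡ _) (sum-zeros[i]≔1 i)

module _ {n : ℕ} (A : Algorithm n) where

  -- Since `step` is a function of the state, runs from a common state take the same kind of step;
  -- mixed cases are contradictory. Agreement on the positions inspected by the first run suffices,
  -- as it keeps the states equal after each inspection.
  answer-determined : ∀ {v w s is js r t} →
    RunFrom A v s is r → RunFrom A w s js t →
    (∀ {i} → i ∈ is → lookup v i ≡ lookup w i) → r ≡ t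
  answer-determined (halts e) (halts e′) _ with refl ← trans (sym e) e′ = refl
  answer-determined (halts e) (computes e′ _) _ with () ← trans (sym e) e′
  answer-determined (halts e) (inspects e′ _) _ with () ← trans (sym e) e′
  answer-determined (computes e _) (halts e′) _ with () ← trans (sym e) e′
  answer-determined (computes e ρ) (computes e′ ρ′) agree
    with refl ← trans (sym e) e′ = answer-determined ρ ρ′ agree
  answer-determined (computes e _) (inspects e′ _) _ with () ← trans (sym e) e′
  answer-determined (inspects e _) (halts e′) _ with () ← trans (sym e) e′
  answer-determined (inspects e _) (computes e′ _) _ with () ← trans (sym e) e′
  answer-determined {v} {w} (inspects {k = k} e ρ) (inspects e′ ρ′) agree
    with refl ← trans (sym e) e′ =
    answer-determined ρ
      -- The value just read is the same in `v` and `w`, so the second run also continues from the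
      -- state reached by the first.
      (subst (λ x → RunFrom A w (k x) _ _) (sym (agree (here refl))) ρ′)
      (λ j∈is → agree (there j∈is))

theorem4p1 : (n : ℕ) (A : Algorithm n) → SolvesStoneGameIII A →
    Σ[ v ∈ Vec ℤ n ] InspectsEveryPosition A v
theorem4p1 n A solves with solves (zeros n)
-- Membership in `is` is decidable, so refuting that `i` was skipped yields an actual membership
-- proof.
... | is , run = zeros n , is , _ , run , λ i → decidable-stable (_∈?_ _≟_ i is) (unskipped i)
  where
  unskipped : ∀ i → ¬ ¬ (i ∈ is)
  unskipped i i∉is = sum≡1⇒¬Tie w (sum-zeros[i]≔1 i) (trans (sym same) (zeros-Tie n))
    where
    w = zeros n [ i ]≔ 1ℤ

    same : stoneGameIII (zeros n) ≡ stoneGameIII w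
    same = answer-determined A run (proj₂ (solves w)) λ {j} j∈is →
      -- An inspected `j` differs from the skipped `i`, so the update at `i` leaves its value
      -- unchanged.
      sym (lookup∘update′ (λ { refl → i∉is j∈is }) (zeros n) 1ℤ)
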